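{- Assume the following Conjecture holds: for every positive integer $n$ and every system $T\subseteq\{x_i+1=x_k,\ x_i\cdot x_j=x_k:\ i,j,k\in\{1,\ldots,n\}\}$ which has only finitely many solutions in positive integers $x_1,\ldots,x_n$, each such solution satisfies $x_1,\ldots,x_n\leqslant f(n)$. Then every set $\mathcal{M}\subseteq\mathbb{N}$ which has a finite-fold Diophantine representation is computable.
   Context: $\mathbb{N}=\{0,1,2,\ldots\}$. Define $f:\mathbb{N}\setminus\{0\}\to\mathbb{N}\setminus\{0\}$ by $f(1)=1$, $f(n)=2^{2^{n-2}}$ for $n\in\{2,3,4,5\}$, and $f(n)=\left(2+2^{2^{n-4}}\right)^{2^{n-4}}$ for $n\geqslant 6$. A set $\mathcal{M}\subseteq\mathbb{N}$ has a finite-fold Diophantine representation if there is a polynomial $W(x,x_1,\ldots,x_m)$ with integer coefficients such that for every $b\in\mathbb{N}$: $b\in\mathcal{M}$ if and only if there exist $x_1,\ldots,x_m\in\mathbb{N}$ with $W(b,x_1,\ldots,x_m)=0$, and for every $b\in\mathbb{N}$ the equation $W(b,x_1,\ldots,x_m)=0$ has only finitely many solutions $(x_1,\ldots,x_m)\in\mathbb{N}^m$. -}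

module Defs where

open import Data.Nat using (ℕ; zero; suc; _+_; _*_; _∸_; _^_; _≤_)
open import Data.Integer as ℤ using (ℤ; +_)
open import Data.Fin using (Fin)
open import Data.Vec using (Vec; lookup; _∷_)
open import Data.List using (List)
open import Data.List.Membership.Propositional using (_∈_)
open import Data.Product using (Σ; ∃; _×_)
open import Relation.Nullary using (¬_; Dec)
open import Relation.Binary.PropositionalEquality using (_≡_)
open import Function.Bundles using (_⇔_)

-- The bound function f (f 0 is an arbitrary filler; only n ≥ 1 is used).
f : ℕ → ℕ
f 0 = 1
f 1 = 1
f 2 = 2 ^ (2 ^ 0)
f 3 = 2 ^ (2 ^ 1)
f 4 = 2 ^ (2 ^ 2)
f 5 = 2 ^ (2 ^ 3)
f n@(suc (suc (suc (suc (suc (suc _)))))) = (2 + 2 ^ (2 ^ (n ∸ 4))) ^ (2 ^ (n ∸ 4))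

data Eqn (n : ℕ) : Set where
  plus1 : (i k : Fin n) → Eqn n
  times : (i j k : Fin n) → Eqn n

Holds : ∀ {n} → Vec ℕ n → Eqn n → Set
Holds x (plus1 i k)   = lookup x i + 1 ≡ lookup x k
Holds x (times i j k) = lookup x i * lookup x j ≡ lookup x k

SolutionPos : ∀ {n} → List (Eqn n) → Vec ℕ n → Set
SolutionPos {n} T x = ((i : Fin n) → 1 ≤ lookup x i) × (∀ e → e ∈ T → Holds x e)

-- Finiteness of a set of tuples (classical notion, read double-negated):
-- "it is not the case that there is no finite list containing all its elements".
Finite : ∀ {m} → (Vec ℕ m → Set) → Set
Finite {m} P = ¬ ¬ (Σ (List (Vec ℕ m)) λ xs → ∀ v → P v → v ∈ xs)

Conjecture : Set
Conjecture = (n : ℕ) → 1 ≤ n → (T : List (Eqn n)) →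
  Finite (SolutionPos T) →
  (x : Vec ℕ n) → SolutionPos T x → (i : Fin n) → lookup x i ≤ f n

data Poly (k : ℕ) : Set where
  const : ℤ → Poly k
  var   : Fin k → Poly k
  _⊕_   : Poly k → Poly k → Poly k
  _⊗_   : Poly k → Poly k → Poly k

eval : ∀ {k} → Poly k → Vec ℕ k → ℤ
eval (const c) ρ = c
eval (var i)   ρ = + (lookup ρ i)
eval (p ⊕ q)   ρ = eval p ρ ℤ.+ eval q ρ
eval (p ⊗ q)   ρ = eval p ρ ℤ.* eval q ρ

-- W(x, x_1, ..., x_m) is a polynomial in m+1 variables; variable 0 is x.
FiniteFoldDiophantine : (ℕ → Set) → Set
FiniteFoldDiophantine M =
  Σ ℕ λ m → Σ (Poly (suc m)) λ W →
    ((b : ℕ) → M b ⇔ (Σ (Vec ℕ m) λ xs → eval W (b ∷ xs) ≡ + 0))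
    × ((b : ℕ) → Finite (λ (xs : Vec ℕ m) → eval W (b ∷ xs) ≡ + 0))

Computable : (ℕ → Set) → Set
Computable M = (b : ℕ) → Dec (M b)

-- Write W = P − N with P, N built from 1 and the shifted unknowns xᵢ + 1 by + and ·.
-- Introducing a fresh variable for every intermediate value turns P = N into a system
-- of equations xᵢ + 1 = xₖ, xᵢ · xⱼ = xₖ over positive integers; an addition z = x + y
-- is expressed through (z x + 1)(z y + 1) = z² (x y + 1) + 1, which for z ≥ 1 says
-- z (x + y) = z². Every positive solution of the system is determined by the values of
-- its input variables, so for a fixed parameter b the system has finitely many solutions
-- when W(b, ·) has finitely many zeros. The conjecture then bounds all zeros of W(b, ·),
-- and a bounded search decides whether one exists.

module Submission where

open import Defs
open import Data.Nat using (ℕ; zero; suc; _+_; _*_; pred; _≤_; s≤s; z<s; >-nonZero)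
open import Data.Nat.Properties
  using (+-suc; +-identityʳ; *-identityˡ; *-identityʳ; *-cancelˡ-≡; *-cancelʳ-≡; +-cancelˡ-≡; suc-pred; ≤-trans; n≤1+n)
open import Data.Integer as ℤ using (+_; -[1+_])
import Data.Integer.Properties as ℤP
open import Algebra.Bundles using (AbelianGroup)
open import Algebra.Properties.Group (AbelianGroup.group ℤP.+-0-abelianGroup) using (∙-cancelʳ)
open import Data.Fin using (Fin; zero; suc; toℕ; fromℕ<)
open import Data.Fin.Properties using (any?; toℕ-fromℕ<)
open import Data.Vec using (Vec; []; _∷_; _++_; lookup; map)
open import Data.Vec.Properties using (∷-injectiveˡ; ++-injectiveˡ; ++-injectiveʳ; lookup-map)
open import Data.Vec.Relation.Binary.Pointwise.Inductive using (≡⇒Pointwise-≡; []; _∷_)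
import Data.Vec.Relation.Unary.All as Allᵥ
import Data.Vec.Relation.Unary.All.Properties as Allᵥₚ
open import Data.List as List using (List; []; _∷_)
open import Data.List.Membership.Propositional using (_∈_)
open import Data.List.Membership.Propositional.Properties using (∈-map⁺)
open import Data.List.Relation.Unary.All as All using (All; []; _∷_)
open import Data.List.Relation.Unary.All.Properties using (++⁺; ++⁻; map⁺)
open import Data.Product using (Σ; ∃; _×_; _,_; proj₁)
open import Function using (_∘_; id)
open import Function.Bundles using (Equivalence)
open import Relation.Nullary using (Dec)
open import Relation.Nullary.Decidable using (map′)
open import Relation.Unary using (Decidable)
open import Relation.Binary.PropositionalEquality
open ≡-Reasoning

module _ where
  open import Data.Integer.Tactic.RingSolver

  +-difference : ∀ a c {p n p′ n′} → a ℤ.+ + n ≡ + p → c ℤ.+ + n′ ≡ + p′ →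
                 (a ℤ.+ c) ℤ.+ + (n + n′) ≡ + (p + p′)
  +-difference a c {p} {n} {p′} {n′} h h′ = begin
    (a ℤ.+ c) ℤ.+ + (n + n′)           ≡⟨ cong (λ u → (a ℤ.+ c) ℤ.+ u) (ℤP.pos-+ n n′) ⟩
    (a ℤ.+ c) ℤ.+ (+ n ℤ.+ + n′)       ≡⟨ interchange a c (+ n) (+ n′) ⟩
    (a ℤ.+ + n) ℤ.+ (c ℤ.+ + n′)       ≡⟨ cong₂ ℤ._+_ h h′ ⟩
    + p ℤ.+ + p′                       ≡⟨ ℤP.pos-+ p p′ ⟨
    + (p + p′)                         ∎
    where
    interchange : ∀ a c n n′ → (a ℤ.+ c) ℤ.+ (n ℤ.+ n′) ≡ (a ℤ.+ n) ℤ.+ (c ℤ.+ n′)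
    interchange = solve-∀

  *-difference : ∀ a c {p n p′ n′} → a ℤ.+ + n ≡ + p → c ℤ.+ + n′ ≡ + p′ →
                 (a ℤ.* c) ℤ.+ + (p * n′ + n * p′) ≡ + (p * p′ + n * n′)
  *-difference a c {p} {n} {p′} {n′} h h′ = begin
    a ℤ.* c ℤ.+ + (p * n′ + n * p′)                      ≡⟨ cong (λ u → a ℤ.* c ℤ.+ u) (pos-+-* p n′ n p′) ⟩
    a ℤ.* c ℤ.+ (+ p ℤ.* + n′ ℤ.+ + n ℤ.* + p′)          ≡⟨ cong₂ (λ u v → a ℤ.* c ℤ.+ (u ℤ.* + n′ ℤ.+ + n ℤ.* v)) h h′ ⟨
    a ℤ.* c ℤ.+ ((a ℤ.+ + n) ℤ.* + n′ ℤ.+ + n ℤ.* (c ℤ.+ + n′)) ≡⟨ expand a c (+ n) (+ n′) ⟩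
    (a ℤ.+ + n) ℤ.* (c ℤ.+ + n′) ℤ.+ + n ℤ.* + n′        ≡⟨ cong₂ (λ u v → u ℤ.* v ℤ.+ + n ℤ.* + n′) h h′ ⟩
    + p ℤ.* + p′ ℤ.+ + n ℤ.* + n′                        ≡⟨ pos-+-* p p′ n n′ ⟨
    + (p * p′ + n * n′)                                  ∎
    where
    pos-+-* : ∀ p q r s → + (p * q + r * s) ≡ + p ℤ.* + q ℤ.+ + r ℤ.* + s
    pos-+-* p q r s = trans (ℤP.pos-+ (p * q) (r * s)) (cong₂ ℤ._+_ (ℤP.pos-* p q) (ℤP.pos-* r s))
    expand : ∀ a c n n′ → a ℤ.* c ℤ.+ ((a ℤ.+ n) ℤ.* n′ ℤ.+ n ℤ.* (c ℤ.+ n′))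
                        ≡ (a ℤ.+ n) ℤ.* (c ℤ.+ n′) ℤ.+ n ℤ.* n′
    expand = solve-∀

  -[1+]-difference : ∀ k → -[1+ k ] ℤ.+ + suc (suc k) ≡ + 1
  -[1+]-difference k = cancel (+ suc k)
    where
    cancel : ∀ a → ℤ.- a ℤ.+ (+ 1 ℤ.+ a) ≡ + 1
    cancel = solve-∀

equal-parts⇒zero : ∀ {a n p} → a ℤ.+ + n ≡ + p → p ≡ n → a ≡ + 0
equal-parts⇒zero {a} {n} h refl = ∙-cancelʳ (+ n) a (+ 0) h

zero⇒equal-parts : ∀ {a n p} → a ℤ.+ + n ≡ + p → a ≡ + 0 → n ≡ p
zero⇒equal-parts h refl = ℤP.+-injective h

data Op : Set where
  add mul : Op

⟦_⟧ₒ : Op → ℕ → ℕ → ℕ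
⟦ add ⟧ₒ = _+_
⟦ mul ⟧ₒ = _*_

-- leaf zero is the constant 1 and leaf (suc i) the unknown xᵢ shifted to xᵢ + 1.
data Expr (m : ℕ) : Set where
  leaf : Fin (suc m) → Expr m
  node : Op → Expr m → Expr m → Expr m

inputs : ∀ {m} → Vec ℕ m → Vec ℕ (suc m)
inputs xs = 1 ∷ map suc xs

⟦_⟧ : ∀ {m} → Expr m → Vec ℕ m → ℕ
⟦ leaf j ⟧       xs = lookup (inputs xs) j
⟦ node o e e′ ⟧ xs = ⟦ o ⟧ₒ (⟦ e ⟧ xs) (⟦ e′ ⟧ xs)

one : ∀ {m} → Expr m
one = leaf zero

numeral : ∀ {m} → ℕ → Expr m
numeral zero    = one
numeral (suc k) = node add one (numeral k)

⟦numeral⟧ : ∀ {m} k (xs : Vec ℕ m) → ⟦ numeral k ⟧ xs ≡ suc k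
⟦numeral⟧ zero    xs = refl
⟦numeral⟧ (suc k) xs = cong suc (⟦numeral⟧ k xs)

inputs-positive : ∀ {m} (xs : Vec ℕ m) → Allᵥ.All (1 ≤_) (inputs xs)
inputs-positive xs = z<s Allᵥ.∷ Allᵥₚ.map⁺ (Allᵥ.universal (λ _ → z<s) xs)

module Parts {m : ℕ} (b : ℕ) where

  positivePart negativePart : Poly (suc m) → Expr m
  positivePart (const (+ k))    = numeral k
  positivePart (const -[1+ k ]) = one
  positivePart (var zero)       = numeral b
  positivePart (var (suc i))    = leaf (suc i)
  positivePart (p ⊕ q) = node add (positivePart p) (positivePart q)
  positivePart (p ⊗ q) = node add (node mul (positivePart p) (positivePart q))
                                  (node mul (negativePart p) (negativePart q))
  negativePart (const (+ k))    = one
  negativePart (const -[1+ k ]) = numeral (suc k)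
  negativePart (var zero)       = one
  negativePart (var (suc i))    = one
  negativePart (p ⊕ q) = node add (negativePart p) (negativePart q)
  negativePart (p ⊗ q) = node add (node mul (positivePart p) (negativePart q))
                                  (node mul (negativePart p) (positivePart q))

  parts-difference : ∀ p (xs : Vec ℕ m) →
                     eval p (b ∷ xs) ℤ.+ + ⟦ negativePart p ⟧ xs ≡ + ⟦ positivePart p ⟧ xs
  parts-difference (const (+ k)) xs rewrite ⟦numeral⟧ k xs = ℤP.+-comm (+ k) (+ 1)
  parts-difference (const -[1+ k ]) xs rewrite ⟦numeral⟧ k xs = -[1+]-difference k
  parts-difference (var zero) xs rewrite ⟦numeral⟧ b xs = ℤP.+-comm (+ b) (+ 1)
  parts-difference (var (suc i)) xs =
    trans (ℤP.+-comm (+ lookup xs i) (+ 1)) (cong +_ (sym (lookup-map i suc xs)))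
  parts-difference (p ⊕ q) xs = +-difference (eval p (b ∷ xs)) (eval q (b ∷ xs)) (parts-difference p xs) (parts-difference q xs)
  parts-difference (p ⊗ q) xs = *-difference (eval p (b ∷ xs)) (eval q (b ∷ xs)) (parts-difference p xs) (parts-difference q xs)

data Constraint : Set where
  _+1≐_ : ℕ → ℕ → Constraint
  _·_≐_ : ℕ → ℕ → ℕ → Constraint

infix 5.5 _+1≐_ _·_≐_

_⊨_ : (ℕ → ℕ) → Constraint → Set
ρ ⊨ (i +1≐ k)   = ρ i + 1 ≡ ρ k
ρ ⊨ (i · j ≐ k) = ρ i * ρ j ≡ ρ k

window : (ℕ → ℕ) → ℕ → (k : ℕ) → Vec ℕ k
window ρ T zero    = []
window ρ T (suc k) = ρ T ∷ window ρ (suc T) k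

window-suc : ∀ ρ T k → window ρ (suc T) k ≡ window (ρ ∘ suc) T k
window-suc ρ T zero    = refl
window-suc ρ T (suc k) = cong (ρ (suc T) ∷_) (window-suc ρ (suc T) k)

window-++ : ∀ ρ T a b → window ρ T (a + b) ≡ window ρ T a ++ window ρ (T + a) b
window-++ ρ T zero b = cong (λ t → window ρ t b) (sym (+-identityʳ T))
window-++ ρ T (suc a) b = cong (ρ T ∷_) (begin
  window ρ (suc T) (a + b)                          ≡⟨ window-++ ρ (suc T) a b ⟩
  window ρ (suc T) a ++ window ρ (suc T + a) b      ≡⟨ cong (λ t → window ρ (suc T) a ++ window ρ t b) (sym (+-suc T a)) ⟩
  window ρ (suc T) a ++ window ρ (T + suc a) b      ∎)

window-++₃ : ∀ ρ T a b c → window ρ T (a + (b + c)) ≡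
             window ρ T a ++ window ρ (T + a) b ++ window ρ (T + a + b) c
window-++₃ ρ T a b c = trans (window-++ ρ T a (b + c)) (cong (window ρ T a ++_) (window-++ ρ (T + a) b c))

split-window₃ : ∀ {ρ T a b c} (u : Vec ℕ a) (v : Vec ℕ b) {w : Vec ℕ c} →
                window ρ T (a + (b + c)) ≡ u ++ v ++ w →
                window ρ T a ≡ u × window ρ (T + a) b ≡ v × window ρ (T + a + b) c ≡ w
split-window₃ {ρ} {T} {a} {b} {c} u v eq =
  ++-injectiveˡ (window ρ T a) u eq′ , ++-injectiveˡ (window ρ (T + a) b) v rest , ++-injectiveʳ (window ρ (T + a) b) v rest
  where
  eq′  = trans (sym (window-++₃ ρ T a b c)) eq
  rest = ++-injectiveʳ (window ρ T a) u eq′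

lookup-window : ∀ ρ {k} (i : Fin k) → lookup (window ρ 0 k) i ≡ ρ (toℕ i)
lookup-window ρ zero = refl
lookup-window ρ {suc k} (suc i) =
  trans (cong (λ v → lookup v i) (window-suc ρ 0 k)) (lookup-window (ρ ∘ suc) i)

window-suc-pred : ∀ {ρ} → (∀ j → 1 ≤ ρ j) → ∀ T k → map suc (map pred (window ρ T k)) ≡ window ρ T k
window-suc-pred     pos T zero    = refl
window-suc-pred {ρ} pos T (suc k) =
  cong₂ _∷_ (suc-pred (ρ T) {{>-nonZero (pos T)}}) (window-suc-pred pos (suc T) k)

-- Gadgets computing x + y and x · y into fresh variables T, T + 1, …

auxiliaries : Op → ℕ
auxiliaries add = 9
auxiliaries mul = 0

auxiliaryValues : ∀ o → ℕ → ℕ → Vec ℕ (auxiliaries o)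
auxiliaryValues add x y =
  z * x ∷ z * x + 1 ∷ z * y ∷ z * y + 1 ∷ (z * x + 1) * (z * y + 1) ∷
  z * z ∷ x * y ∷ x * y + 1 ∷ z * z * (x * y + 1) ∷ []
  where z = x + y
auxiliaryValues mul x y = []

gadgetValues : ∀ o → ℕ → ℕ → Vec ℕ (suc (auxiliaries o))
gadgetValues o x y = ⟦ o ⟧ₒ x y ∷ auxiliaryValues o x y

gadget : Op → ℕ → ℕ → ℕ → List Constraint
gadget add a c T =
  T · a ≐ 1 + T ∷ 1 + T +1≐ 2 + T ∷ T · c ≐ 3 + T ∷ 3 + T +1≐ 4 + T ∷
  2 + T · 4 + T ≐ 5 + T ∷ T · T ≐ 6 + T ∷ a · c ≐ 7 + T ∷ 7 + T +1≐ 8 + T ∷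
  6 + T · 8 + T ≐ 9 + T ∷ 9 + T +1≐ 5 + T ∷ []
gadget mul a c T = a · c ≐ T ∷ []

module _ where
  open import Data.Nat.Tactic.RingSolver

  forces-sum : ∀ {x y z} → 1 ≤ z → z * z * (x * y + 1) + 1 ≡ (z * x + 1) * (z * y + 1) → z ≡ x + y
  forces-sum {x} {y} {z} z≥1 eq =
    *-cancelˡ-≡ z (x + y) z {{>-nonZero z≥1}} (+-cancelˡ-≡ (z * z * (x * y) + 1) _ _ (begin
      z * z * (x * y) + 1 + z * z       ≡⟨ left z x y ⟩
      z * z * (x * y + 1) + 1           ≡⟨ eq ⟩
      (z * x + 1) * (z * y + 1)         ≡⟨ right z x y ⟩
      z * z * (x * y) + 1 + z * (x + y) ∎))
    where
    left : ∀ z x y → z * z * (x * y) + 1 + z * z ≡ z * z * (x * y + 1) + 1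
    left = solve-∀
    right : ∀ z x y → (z * x + 1) * (z * y + 1) ≡ z * z * (x * y) + 1 + z * (x + y)
    right = solve-∀

  sum-identity : ∀ x y → (x + y) * (x + y) * (x * y + 1) + 1 ≡ ((x + y) * x + 1) * ((x + y) * y + 1)
  sum-identity = solve-∀

add-gadget-values : ∀ {x y z t₁ t₂ t₃ t₄ t₅ t₆ t₇ t₈ t₉} → 1 ≤ z →
  z * x ≡ t₁ → t₁ + 1 ≡ t₂ → z * y ≡ t₃ → t₃ + 1 ≡ t₄ → t₂ * t₄ ≡ t₅ →
  z * z ≡ t₆ → x * y ≡ t₇ → t₇ + 1 ≡ t₈ → t₆ * t₈ ≡ t₉ → t₉ + 1 ≡ t₅ →
  z ∷ t₁ ∷ t₂ ∷ t₃ ∷ t₄ ∷ t₅ ∷ t₆ ∷ t₇ ∷ t₈ ∷ t₉ ∷ [] ≡ gadgetValues add x y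
add-gadget-values z≥1 refl refl refl refl refl refl refl refl refl last with forces-sum z≥1 last
... | refl = refl

gadget-sound : ∀ o {ρ a c T} → 1 ≤ ρ T → All (ρ ⊨_) (gadget o a c T) →
               window ρ T (suc (auxiliaries o)) ≡ gadgetValues o (ρ a) (ρ c)
gadget-sound add z≥1 (e₁ ∷ e₂ ∷ e₃ ∷ e₄ ∷ e₅ ∷ e₆ ∷ e₇ ∷ e₈ ∷ e₉ ∷ e₁₀ ∷ []) =
  add-gadget-values z≥1 e₁ e₂ e₃ e₄ e₅ e₆ e₇ e₈ e₉ e₁₀
gadget-sound mul _ (e ∷ []) = cong (_∷ []) (sym e)

gadget-complete : ∀ o {ρ a c T} → window ρ T (suc (auxiliaries o)) ≡ gadgetValues o (ρ a) (ρ c) →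
                  All (ρ ⊨_) (gadget o a c T)
gadget-complete add {ρ} {a} {c} eq with ≡⇒Pointwise-≡ eq
... | z ∷ t₁ ∷ t₂ ∷ t₃ ∷ t₄ ∷ t₅ ∷ t₆ ∷ t₇ ∷ t₈ ∷ t₉ ∷ [] =
  trans (cong (_* ρ a) z) (sym t₁) ∷
  trans (cong (_+ 1) t₁) (sym t₂) ∷
  trans (cong (_* ρ c) z) (sym t₃) ∷
  trans (cong (_+ 1) t₃) (sym t₄) ∷
  trans (cong₂ _*_ t₂ t₄) (sym t₅) ∷
  trans (cong₂ _*_ z z) (sym t₆) ∷
  sym t₇ ∷
  trans (cong (_+ 1) t₇) (sym t₈) ∷
  trans (cong₂ _*_ t₆ t₈) (sym t₉) ∷
  trans (cong (_+ 1) t₉) (trans (sum-identity (ρ a) (ρ c)) (sym t₅)) ∷ []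
gadget-complete mul eq = sym (∷-injectiveˡ eq) ∷ []

gadgetValues-positive : ∀ o {x y} → 1 ≤ x → 1 ≤ y → Allᵥ.All (1 ≤_) (gadgetValues o x y)
gadgetValues-positive add {suc _} {suc _} _ _ =
  z<s Allᵥ.∷ z<s Allᵥ.∷ z<s Allᵥ.∷ z<s Allᵥ.∷ z<s Allᵥ.∷ z<s Allᵥ.∷ z<s Allᵥ.∷ z<s Allᵥ.∷ z<s Allᵥ.∷ z<s Allᵥ.∷ Allᵥ.[]
gadgetValues-positive mul {suc _} {suc _} _ _ = z<s Allᵥ.∷ Allᵥ.[]

module Compile {m : ℕ} where

  Context : (ℕ → ℕ) → Vec ℕ m → Set
  Context ρ xs = window ρ 0 (suc m) ≡ inputs xs

  context-input : ∀ {ρ xs} → Context ρ xs → ∀ i → ρ (suc (toℕ i)) ≡ suc (lookup xs i)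
  context-input {ρ} {xs} ctx i =
    trans (sym (lookup-window ρ (suc i))) (trans (cong (λ v → lookup v (suc i)) ctx) (lookup-map i suc xs))

  width : Expr m → ℕ
  width (leaf _)       = 0
  width (node o e e′) = width e + (width e′ + suc (auxiliaries o))

  -- The fresh variables of e compiled at T are T, …, T + width e − 1.
  out : Expr m → ℕ → ℕ
  out (leaf j)       T = toℕ j
  out (node o e e′) T = T + width e + width e′

  gates : Expr m → ℕ → List Constraint
  gates (leaf _)       T = List.[]
  gates (node o e e′) T =
    gates e T List.++ gates e′ (T + width e) List.++
    gadget o (out e T) (out e′ (T + width e)) (out (node o e e′) T)

  values : (e : Expr m) → Vec ℕ m → Vec ℕ (width e)
  values (leaf _)       xs = []
  values (node o e e′) xs = values e xs ++ values e′ xs ++ gadgetValues o (⟦ e ⟧ xs) (⟦ e′ ⟧ xs)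

  ⟦⟧-positive : ∀ (e : Expr m) xs → 1 ≤ ⟦ e ⟧ xs
  ⟦⟧-positive (leaf j)       xs = Allᵥₚ.lookup⁺ (inputs-positive xs) j
  ⟦⟧-positive (node o e e′) xs = Allᵥ.head (gadgetValues-positive o (⟦⟧-positive e xs) (⟦⟧-positive e′ xs))

  values-positive : ∀ (e : Expr m) xs → Allᵥ.All (1 ≤_) (values e xs)
  values-positive (leaf _)       xs = Allᵥ.[]
  values-positive (node o e e′) xs = Allᵥₚ.++⁺ (values-positive e xs) (Allᵥₚ.++⁺ (values-positive e′ xs)
    (gadgetValues-positive o (⟦⟧-positive e xs) (⟦⟧-positive e′ xs)))

  module _ {ρ : ℕ → ℕ} {xs : Vec ℕ m} (ctx : Context ρ xs) where

    out-value : ∀ e T → window ρ T (width e) ≡ values e xs → ρ (out e T) ≡ ⟦ e ⟧ xs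
    out-value (leaf j) T _ = trans (sym (lookup-window ρ j)) (cong (λ v → lookup v j) ctx)
    out-value (node o e e′) T eq with split-window₃ (values e xs) (values e′ xs) eq
    ... | _ , _ , eq₃ = ∷-injectiveˡ eq₃

    gadget-inputs : ∀ o e e′ T → window ρ T (width e) ≡ values e xs →
                    window ρ (T + width e) (width e′) ≡ values e′ xs →
                    gadgetValues o (ρ (out e T)) (ρ (out e′ (T + width e))) ≡ gadgetValues o (⟦ e ⟧ xs) (⟦ e′ ⟧ xs)
    gadget-inputs o e e′ T eq₁ eq₂ = cong₂ (gadgetValues o) (out-value e T eq₁) (out-value e′ (T + width e) eq₂)

    gates-sound : (∀ j → 1 ≤ ρ j) → ∀ e T → All (ρ ⊨_) (gates e T) → window ρ T (width e) ≡ values e xs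
    gates-sound pos (leaf _) T _ = refl
    gates-sound pos (node o e e′) T sat with ++⁻ (gates e T) sat
    ... | sat₁ , sat₂₃ with ++⁻ (gates e′ (T + width e)) sat₂₃
    ... | sat₂ , sat₃ =
      trans (window-++₃ ρ T (width e) (width e′) (suc (auxiliaries o))) (cong₂ _++_ eq₁ (cong₂ _++_ eq₂ eq₃))
      where
      eq₁ = gates-sound pos e T sat₁
      eq₂ = gates-sound pos e′ (T + width e) sat₂
      eq₃ = trans (gadget-sound o (pos _) sat₃) (gadget-inputs o e e′ T eq₁ eq₂)

    gates-complete : ∀ e T → window ρ T (width e) ≡ values e xs → All (ρ ⊨_) (gates e T)
    gates-complete (leaf _) T _ = []
    gates-complete (node o e e′) T eq with split-window₃ (values e xs) (values e′ xs) eq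
    ... | eq₁ , eq₂ , eq₃ =
      ++⁺ (gates-complete e T eq₁) (++⁺ (gates-complete e′ (T + width e) eq₂)
        (gadget-complete o (trans eq₃ (sym (gadget-inputs o e e′ T eq₁ eq₂)))))

-- The system of a polynomial with its parameter fixed

idempotent-positive : ∀ {a} → 1 ≤ a → a * a ≡ a → a ≡ 1
idempotent-positive {a} a≥1 eq = *-cancelʳ-≡ a 1 a {{>-nonZero a≥1}} (trans eq (sym (*-identityˡ a)))

module System {m : ℕ} (b : ℕ) (W : Poly (suc m)) where
  open Parts {m} b
  open Compile {m}

  P N : Expr m
  P = positivePart W
  N = negativePart W

  size : ℕ
  size = suc m + (width P + width N)

  -- In positive integers x₀ · x₀ = x₀ forces x₀ = 1, and then P · x₀ = N says W(b, x) = 0.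
  constraints : List Constraint
  constraints = 0 · 0 ≐ 0 ∷ out P (suc m) · 0 ≐ out N (suc m + width P) ∷
                gates P (suc m) List.++ gates N (suc m + width P)

  layout : Vec ℕ m → Vec ℕ size
  layout xs = inputs xs ++ values P xs ++ values N xs

  layout-positive : ∀ xs → Allᵥ.All (1 ≤_) (layout xs)
  layout-positive xs = Allᵥₚ.++⁺ (inputs-positive xs) (Allᵥₚ.++⁺ (values-positive P xs) (values-positive N xs))

  inputsOf : (ℕ → ℕ) → Vec ℕ m
  inputsOf ρ = map pred (window ρ 1 m)

  module _ {ρ : ℕ → ℕ} {xs : Vec ℕ m} (ctx : Context ρ xs)
           (eqP : window ρ (suc m) (width P) ≡ values P xs)
           (eqN : window ρ (suc m + width P) (width N) ≡ values N xs) where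

    balanced⇒root : ρ (out P (suc m)) * ρ 0 ≡ ρ (out N (suc m + width P)) → eval W (b ∷ xs) ≡ + 0
    balanced⇒root balance = equal-parts⇒zero (parts-difference W xs) (begin
      ⟦ P ⟧ xs                              ≡⟨ sym (out-value ctx P (suc m) eqP) ⟩
      ρ (out P (suc m))                     ≡⟨ sym (*-identityʳ _) ⟩
      ρ (out P (suc m)) * 1                 ≡⟨ cong (ρ (out P (suc m)) *_) (sym (∷-injectiveˡ ctx)) ⟩
      ρ (out P (suc m)) * ρ 0               ≡⟨ balance ⟩
      ρ (out N (suc m + width P))           ≡⟨ out-value ctx N (suc m + width P) eqN ⟩
      ⟦ N ⟧ xs                              ∎)

    root⇒balanced : eval W (b ∷ xs) ≡ + 0 → ρ (out P (suc m)) * ρ 0 ≡ ρ (out N (suc m + width P))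
    root⇒balanced root = begin
      ρ (out P (suc m)) * ρ 0               ≡⟨ cong (ρ (out P (suc m)) *_) (∷-injectiveˡ ctx) ⟩
      ρ (out P (suc m)) * 1                 ≡⟨ *-identityʳ _ ⟩
      ρ (out P (suc m))                     ≡⟨ out-value ctx P (suc m) eqP ⟩
      ⟦ P ⟧ xs                              ≡⟨ sym (zero⇒equal-parts (parts-difference W xs) root) ⟩
      ⟦ N ⟧ xs                              ≡⟨ sym (out-value ctx N (suc m + width P) eqN) ⟩
      ρ (out N (suc m + width P))           ∎

  constraints-sound : ∀ {ρ} → (∀ j → 1 ≤ ρ j) → All (ρ ⊨_) constraints →
                      eval W (b ∷ inputsOf ρ) ≡ + 0 × window ρ 0 size ≡ layout (inputsOf ρ)
  constraints-sound {ρ} pos (unit ∷ balance ∷ sat) with ++⁻ (gates P (suc m)) sat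
  ... | satP , satN = balanced⇒root ctx eqP eqN balance ,
                      trans (window-++₃ ρ 0 (suc m) (width P) (width N)) (cong₂ _++_ ctx (cong₂ _++_ eqP eqN))
    where
    ctx : Context ρ (inputsOf ρ)
    ctx = cong₂ _∷_ (idempotent-positive (pos 0) unit) (sym (window-suc-pred pos 1 m))
    eqP = gates-sound ctx pos P (suc m) satP
    eqN = gates-sound ctx pos N (suc m + width P) satN

  constraints-complete : ∀ {ρ xs} → eval W (b ∷ xs) ≡ + 0 → window ρ 0 size ≡ layout xs → All (ρ ⊨_) constraints
  constraints-complete {ρ} {xs} root eq with split-window₃ (inputs xs) (values P xs) eq
  ... | ctx , eqP , eqN =
    unit ∷ root⇒balanced ctx eqP eqN root ∷ ++⁺ (gates-complete ctx P (suc m) eqP) (gates-complete ctx N (suc m + width P) eqN)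
    where
    unit : ρ 0 * ρ 0 ≡ ρ 0
    unit = trans (cong₂ _*_ ρ₀ ρ₀) (sym ρ₀) where ρ₀ = ∷-injectiveˡ ctx

  layout-context : ∀ {ρ} xs → window ρ 0 size ≡ layout xs → Context ρ xs
  layout-context xs eq = proj₁ (split-window₃ (inputs xs) (values P xs) eq)

-- Indices past the end are clamped to the last one; no constraint of a system mentions them.
clamp : ∀ {n} → ℕ → Fin (suc n)
clamp {zero}  _       = zero
clamp {suc n} zero    = zero
clamp {suc n} (suc j) = suc (clamp j)

valuation : ∀ {n} → Vec ℕ (suc n) → ℕ → ℕ
valuation y j = lookup y (clamp j)

toEqn : ∀ {n} → Constraint → Eqn (suc n)
toEqn (i +1≐ k)   = plus1 (clamp i) (clamp k)
toEqn (i · j ≐ k) = times (clamp i) (clamp j) (clamp k)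

window-valuation : ∀ {n} (y : Vec ℕ (suc n)) → window (valuation y) 0 (suc n) ≡ y
window-valuation {zero}  (v ∷ []) = refl
window-valuation {suc n} (v ∷ y)  = cong (v ∷_) (trans (window-suc (valuation (v ∷ y)) 0 (suc n)) (window-valuation y))

Holds-toEqn : ∀ {n} (y : Vec ℕ (suc n)) c → Holds y (toEqn c) ≡ (valuation y ⊨ c)
Holds-toEqn y (i +1≐ k)   = refl
Holds-toEqn y (i · j ≐ k) = refl

solution⇒satisfies : ∀ {n} {y : Vec ℕ (suc n)} cs → SolutionPos (List.map toEqn cs) y →
                     (∀ j → 1 ≤ valuation y j) × All (valuation y ⊨_) cs
solution⇒satisfies {y = y} cs (pos , holds) =
  (λ j → pos (clamp j)) ,
  All.tabulate (λ {c} c∈cs → subst id (Holds-toEqn y c) (holds (toEqn c) (∈-map⁺ toEqn c∈cs)))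

satisfies⇒solution : ∀ {n} {y : Vec ℕ (suc n)} cs → Allᵥ.All (1 ≤_) y → All (valuation y ⊨_) cs →
                     SolutionPos (List.map toEqn cs) y
satisfies⇒solution {y = y} cs pos sat =
  Allᵥₚ.lookup⁺ pos ,
  λ e e∈ → All.lookup (map⁺ (All.map (λ {c} → subst id (sym (Holds-toEqn y c))) sat)) e∈

Finite-determined : ∀ {m n} {P : Vec ℕ m → Set} {Q : Vec ℕ n → Set}
                    (g : Vec ℕ m → Vec ℕ n) (h : Vec ℕ n → Vec ℕ m) →
                    (∀ y → Q y → P (h y) × y ≡ g (h y)) → Finite P → Finite Q
Finite-determined g h determined finiteP no-cover = finiteP λ (xs , covers) →
  no-cover (List.map g xs , λ y q → let p , y≡ = determined y q in
    subst (_∈ List.map g xs) (sym y≡) (∈-map⁺ g (covers (h y) p)))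

bounded-search : ∀ B k {P : Vec ℕ k → Set} → Decidable P → (∀ v → P v → ∀ i → lookup v i ≤ B) → Dec (∃ P)
bounded-search B zero    P? _ = map′ ([] ,_) (λ { ([] , p) → p }) (P? [])
bounded-search B (suc k) {P} P? bound =
  map′ (λ (c , v , p) → toℕ c ∷ v , p) within-bound
    (any? λ c → bounded-search B k (P? ∘ (toℕ c ∷_)) (λ v p i → bound _ p (suc i)))
  where
  within-bound : ∃ P → ∃ λ (c : Fin (suc B)) → ∃ λ v → P (toℕ c ∷ v)
  within-bound (x ∷ v , p) = fromℕ< x<1+B , v , subst (λ x → P (x ∷ v)) (sym (toℕ-fromℕ< x<1+B)) p
    where x<1+B = s≤s (bound _ p zero)

module Decision (conjecture : Conjecture) {m : ℕ} (W : Poly (suc m))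
                (finite : ∀ b → Finite (λ (xs : Vec ℕ m) → eval W (b ∷ xs) ≡ + 0)) (b : ℕ) where
  open System b W
  open Compile {m} using (context-input)

  system : List (Eqn size)
  system = List.map toEqn constraints

  project : Vec ℕ size → Vec ℕ m
  project y = inputsOf (valuation y)

  solution-sound : ∀ y → SolutionPos system y → eval W (b ∷ project y) ≡ + 0 × y ≡ layout (project y)
  solution-sound y sol with solution⇒satisfies constraints sol
  ... | pos , sat with constraints-sound pos sat
  ... | root , eq = root , trans (sym (window-valuation y)) eq

  solution-complete : ∀ xs → eval W (b ∷ xs) ≡ + 0 → SolutionPos system (layout xs)
  solution-complete xs root = satisfies⇒solution constraints (layout-positive xs)
    (constraints-complete root (window-valuation (layout xs)))

  finitely-many : Finite (SolutionPos system)
  finitely-many = Finite-determined layout project solution-sound (finite b)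

  -- The conjecture is applied to variable suc i of the solution, which holds xᵢ + 1.
  zeros-bounded : ∀ xs → eval W (b ∷ xs) ≡ + 0 → ∀ i → lookup xs i ≤ f size
  zeros-bounded xs root i = ≤-trans (n≤1+n _) (subst (_≤ f size)
    (context-input {xs = xs} (layout-context xs (window-valuation (layout xs))) i)
    (conjecture size z<s system finitely-many (layout xs) (solution-complete xs root) (clamp (suc (toℕ i)))))

  decide : Dec (Σ (Vec ℕ m) λ xs → eval W (b ∷ xs) ≡ + 0)
  decide = bounded-search (f size) m (λ xs → eval W (b ∷ xs) ℤ.≟ + 0) zeros-bounded

theorem5 : Conjecture → (M : ℕ → Set) → FiniteFoldDiophantine M → Computable M
theorem5 conjecture M (m , W , represents , finite) b =
  map′ (Equivalence.from (represents b)) (Equivalence.to (represents b)) (Decision.decide conjecture W finite b)
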